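{- Let $n\ge1$. If $H$ is dense in $\widehat{\mathcal F_n}$, then the Kripke model $\mathfrak K_n=(K_n,\le,\mathrm{val})$ is (first-order) interpretable in $H$ with parameters $a_1,\dots,a_n$, where $a_1,\dots,a_n$ are the pre-generators.
   Context: Fix $n\ge1$ and symbols $P_1,\dots,P_n$. The generic Kripke model $\mathfrak K_n=(K_n,\le,\mathrm{val})$ consists of a partially ordered set $(K_n,\le)$ and a valuation map $\mathrm{val}:K_n\to\mathfrak P(\{P_1,\dots,P_n\})$; it is the increasing union of finite pieces $K_n^d$ ($d\ge 0$) built recursively: $K_n^{ -1}=\emptyset$, and $K_n^d\setminus K_n^{d-1}$ consists of exactly one point $w_{\beta,Y}$ for each pair $(\beta,Y)$ such that (i) $Y$ is a decreasing subset of $K_n^{d-1}$ with $Y\not\subseteq K_n^{d-2}$ (for $d=0$ this last condition is void, so $Y=\emptyset$); (ii) $\beta\subseteq\{P_1,\dots,P_n\}$ and $\beta\subseteq\mathrm{val}(w')$ for all $w'\in Y$; (iii) if $Y$ is the decreasing set generated by a single element $w_{\beta',Y'}$, then $\beta\ne\beta'$. One sets $\mathrm{val}(w_{\beta,Y})=\beta$, and $w\le w_{\beta,Y}$ iff $w\in Y$ or $w=w_{\beta,Y}$. As a first-order structure, $\mathfrak K_n$ is the set $K_n$ with the binary relation $\le$ and, for each $I\subseteq\{1,\dots,n\}$, the unary relation "$\mathrm{val}(x)=\{P_i: i\in I\}$". $\widehat{\mathcal F_n}:=\mathcal O_\downarrow(K_n,\le)$ is the Heyting algebra of all decreasing subsets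 of $K_n$ ($\sqcap=\cap$, $\sqcup=\cup$, $a\to b$ = the largest decreasing set contained in $(K_n\setminus a)\cup b$), considered in the language $\mathcal L_{HA}=\{0,1,\sqcap,\sqcup,\to\}$. It carries the metric $\mathrm d(a,b)=2^{ -\min\{i\in\mathbb N\mid a\cap K_n^i\neq b\cap K_n^i\}}$ ($2^{ -\min\emptyset}=0$). "$H$ is dense in $\widehat{\mathcal F_n}$" means that $H$ is a Heyting sub-algebra of $\widehat{\mathcal F_n}$ that is dense for this metric; such an $H$ contains all finite decreasing subsets of $K_n$. The pre-generators are the atoms $a_i=\{w_{\{P_i\},\emptyset}\}$, $i=1,\dots,n$. -}

module Defs where

open import Level using (Level; 0ℓ; _⊔_) renaming (suc to lsuc)
open import Axiom.ExcludedMiddle using (ExcludedMiddle)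
open import Data.Empty using (⊥; ⊥-elim)
open import Data.Unit using (⊤; tt)
open import Data.Nat as ℕ using (ℕ; zero)
open import Data.Nat.Properties using (m^n≢0)
open import Data.Integer using (+_)
open import Data.Rational as ℚ using (ℚ; 0ℚ)
open import Data.Fin using (Fin; zero; suc)
open import Data.Fin.Subset as Subset using (Subset; ⁅_⁆)
open import Data.List using (List; []; _∷_)
open import Data.List.Relation.Unary.All as All using (All; []; _∷_)
open import Data.List.Relation.Unary.Any as Any using (Any; here; there)
open import Data.Vec.Functional as Vector using (Vector)
open import Data.Product using (Σ; ∃; _×_; _,_; proj₁; proj₂)
open import Data.Sum using (_⊎_; inj₁; inj₂; [_,_]′)
open import Function using (id; _∘_; _⇔_; mk⇔; Equivalence)
open import Function.Metric.Rational using (DistanceFunction)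
open import Relation.Binary using (Rel; IsEquivalence; Setoid; Poset; _Respects_)
open import Relation.Binary.Lattice using (HeytingAlgebra)
import Relation.Binary.Lattice.Properties.HeytingAlgebra as HeytingProperties
import Relation.Binary.Lattice.Properties.JoinSemilattice as JoinProperties
import Relation.Binary.Lattice.Properties.MeetSemilattice as MeetProperties
open import Relation.Binary.PropositionalEquality using (_≡_; _≢_; refl; sym; trans; subst)
open import Relation.Nullary using (¬_; yes; no)
open import Relation.Unary using (Pred; _∈_; _⊆_; _∩_; _∪_; ∅; U; _≐_)

record Signature : Set₁ where
  field
    FunSym   : Set
    RelSym   : Set
    funArity : FunSym → ℕ
    relArity : RelSym → ℕ

open Signature public

data Term (L : Signature) (k : ℕ) : Set where
  var : Fin k → Term L k
  app : (f : FunSym L) → Vector (Term L k) (funArity L f) → Term L k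

infix  7 _≈′_
infixr 6 _∧′_
infixr 5 _∨′_
infixr 4 _⇒′_

-- Formulas with free variables in Fin k; a quantifier binds the variable zero.
data Formula (L : Signature) (k : ℕ) : Set where
  _≈′_           : Term L k → Term L k → Formula L k
  rel            : (R : RelSym L) → Vector (Term L k) (relArity L R) → Formula L k
  ⊥′             : Formula L k
  _∧′_ _∨′_ _⇒′_ : Formula L k → Formula L k → Formula L k
  ∀′ ∃′          : Formula L (ℕ.suc k) → Formula L k

-- The symbol ≈′ is always interpreted by the equality _≈_ of the structure.
record Structure (L : Signature) (c ℓ : Level) : Set (lsuc (c ⊔ ℓ)) where
  infix 4 _≈_
  field
    Carrier       : Set c
    _≈_           : Rel Carrier ℓ
    isEquivalence : IsEquivalence _≈_
    fun           : (f : FunSym L) → Vector Carrier (funArity L f) → Carrier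
    fun-cong      : ∀ f {xs ys} → (∀ i → xs i ≈ ys i) → fun f xs ≈ fun f ys
    Rel⟦_⟧        : (R : RelSym L) → Pred (Vector Carrier (relArity L R)) ℓ
    rel-resp      : ∀ R {xs ys} → (∀ i → xs i ≈ ys i) → Rel⟦ R ⟧ xs → Rel⟦ R ⟧ ys

module _ {L : Signature} {c ℓ} (A : Structure L c ℓ) where
  open Structure A

  eval : ∀ {k} → Vector Carrier k → Term L k → Carrier
  eval ρ (var i)    = ρ i
  eval ρ (app f ts) = fun f (λ i → eval ρ (ts i))

  infix 3 _⊨_
  _⊨_ : ∀ {k} → Vector Carrier k → Formula L k → Set (c ⊔ ℓ)
  ρ ⊨ (s ≈′ t)   = Level.Lift c (eval ρ s ≈ eval ρ t)
  ρ ⊨ (rel R ts) = Level.Lift c (Rel⟦ R ⟧ (λ i → eval ρ (ts i)))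
  ρ ⊨ ⊥′         = Level.Lift (c ⊔ ℓ) ⊥
  ρ ⊨ (φ ∧′ ψ)   = (ρ ⊨ φ) × (ρ ⊨ ψ)
  ρ ⊨ (φ ∨′ ψ)   = (ρ ⊨ φ) ⊎ (ρ ⊨ ψ)
  ρ ⊨ (φ ⇒′ ψ)   = (ρ ⊨ φ) → (ρ ⊨ ψ)
  ρ ⊨ (∀′ φ)     = ∀ a → (a Vector.∷ ρ) ⊨ φ
  ρ ⊨ (∃′ φ)     = ∃ λ a → (a Vector.∷ ρ) ⊨ φ

  record IsSubalgebra {h} (H : Pred Carrier h) : Set (c ⊔ ℓ ⊔ h) where
    field
      resp-≈ : H Respects _≈_
      closed : ∀ f xs → (∀ i → xs i ∈ H) → fun f xs ∈ H

  substructure : ∀ {h} {H : Pred Carrier h} → IsSubalgebra H → Structure L (c ⊔ h) ℓ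
  substructure {H = H} sub = record
    { Carrier       = ∃ H
    ; _≈_           = λ x y → proj₁ x ≈ proj₁ y
    ; isEquivalence = record
      { refl  = Eq.refl
      ; sym   = Eq.sym
      ; trans = Eq.trans
      }
    ; fun           = λ f xs → fun f (proj₁ ∘ xs) , IsSubalgebra.closed sub f (proj₁ ∘ xs) (proj₂ ∘ xs)
    ; fun-cong      = λ f → fun-cong f
    ; Rel⟦_⟧        = λ R xs → Rel⟦ R ⟧ (proj₁ ∘ xs)
    ; rel-resp      = λ R → rel-resp R
    }
    where module Eq = IsEquivalence isEquivalence

-- The unnested atomic formulas x₀ ≈ x₁, R(x₀,…) and f(x₁,…) ≈ x₀.
data Atomic (L : Signature) : Set where
  equality : Atomic L
  relation : RelSym L → Atomic L
  graph    : FunSym L → Atomic L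

arity : ∀ {L} → Atomic L → ℕ
arity {L} equality     = 2
arity {L} (relation R) = relArity L R
arity {L} (graph f)    = ℕ.suc (funArity L f)

Holds : ∀ {L c ℓ} (B : Structure L c ℓ) (α : Atomic L) → Pred (Vector (Structure.Carrier B) (arity α)) ℓ
Holds B equality     xs = Structure._≈_ B (xs zero) (xs (suc zero))
Holds B (relation R) xs = Structure.Rel⟦_⟧ B R xs
Holds B (graph f)    xs = Structure._≈_ B (Structure.fun B f (Vector.tail xs)) (Vector.head xs)

-- An interpretation of B in A with parameters p: tuples of a fixed length dim
-- satisfying a domain formula are mapped onto B, and the preimage of every
-- unnested atomic relation of B (equality included) is defined by a formula.
-- The first k variables of each formula stand for the parameters.
record Interpretation {L M c ℓ c′ ℓ′ k} (A : Structure L c ℓ) (p : Vector (Structure.Carrier A) k)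
                      (B : Structure M c′ ℓ′) : Set (c ⊔ ℓ ⊔ c′ ⊔ ℓ′) where
  private
    module A = Structure A
    module B = Structure B
  field
    dim      : ℕ
    domain   : Formula L (k ℕ.+ dim)
    formula  : (α : Atomic M) → Formula L (k ℕ.+ arity α ℕ.* dim)

  InDomain : Pred (Vector A.Carrier dim) (c ⊔ ℓ)
  InDomain xs = _⊨_ A (p Vector.++ xs) domain

  field
    coordinate : ∀ xs → xs ∈ InDomain → B.Carrier
    surjective : ∀ b → ∃ λ xs → Σ (xs ∈ InDomain) λ xs∈ → coordinate xs xs∈ B.≈ b
    correct    : ∀ α (xss : Vector (Vector A.Carrier dim) (arity α)) (xss∈ : ∀ i → xss i ∈ InDomain) →
                 _⊨_ A (p Vector.++ Vector.concat xss) (formula α) ⇔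
                 Holds B α (λ i → coordinate (xss i) (xss∈ i))

data HeytingSymbol : Set where
  0ʰ 1ʰ ⊓ʰ ⊔ʰ →ʰ : HeytingSymbol

ℒHA : Signature
ℒHA = record
  { FunSym   = HeytingSymbol
  ; RelSym   = ⊥
  ; funArity = λ { 0ʰ → 0 ; 1ʰ → 0 ; ⊓ʰ → 2 ; ⊔ʰ → 2 ; →ʰ → 2 }
  ; relArity = λ ()
  }

heytingStructure : ∀ {c ℓ₁ ℓ₂} → HeytingAlgebra c ℓ₁ ℓ₂ → Structure ℒHA c ℓ₁
heytingStructure 𝓗 = record
  { Carrier       = H.Carrier
  ; _≈_           = H._≈_
  ; isEquivalence = H.isEquivalence
  ; fun           = λ where
      0ʰ _  → H.⊥
      1ʰ _  → H.⊤
      ⊓ʰ xs → xs zero H.∧ xs (suc zero)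
      ⊔ʰ xs → xs zero H.∨ xs (suc zero)
      →ʰ xs → xs zero H.⇨ xs (suc zero)
  ; fun-cong      = λ where
      0ʰ _  → H.Eq.refl
      1ʰ _  → H.Eq.refl
      ⊓ʰ eq → MeetProperties.∧-cong H.meetSemilattice (eq zero) (eq (suc zero))
      ⊔ʰ eq → JoinProperties.∨-cong H.joinSemilattice (eq zero) (eq (suc zero))
      →ʰ eq → HeytingProperties.⇨-cong 𝓗 (eq zero) (eq (suc zero))
  ; Rel⟦_⟧        = λ ()
  ; rel-resp      = λ ()
  }
  where module H = HeytingAlgebra 𝓗

module _ (P : Poset 0ℓ 0ℓ 0ℓ) where
  private module P = Poset P

  record DownSet : Set₁ where
    field
      set        : Pred P.Carrier 0ℓ
      decreasing : ∀ {u v} → u P.≤ v → v ∈ set → u ∈ set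

  open DownSet

  -- Classically, the exponential below is the largest decreasing subset of
  -- (P ∖ a) ∪ b.
  𝓞↓ : HeytingAlgebra (lsuc 0ℓ) 0ℓ 0ℓ
  𝓞↓ = record
    { Carrier = DownSet
    ; _≈_ = λ a b → set a ≐ set b
    ; _≤_ = λ a b → set a ⊆ set b
    ; _∨_ = λ a b → record
        { set = set a ∪ set b
        ; decreasing = λ u≤v → [ inj₁ ∘ decreasing a u≤v , inj₂ ∘ decreasing b u≤v ]′ }
    ; _∧_ = λ a b → record
        { set = set a ∩ set b
        ; decreasing = λ u≤v (p , q) → decreasing a u≤v p , decreasing b u≤v q }
    ; _⇨_ = λ a b → record
        { set = λ v → ∀ u → u P.≤ v → u ∈ set a → u ∈ set b
        ; decreasing = λ u≤v h t t≤u → h t (P.trans t≤u u≤v) }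
    ; ⊤ = record { set = U ; decreasing = λ _ _ → tt }
    ; ⊥ = record { set = ∅ ; decreasing = λ _ () }
    ; isHeytingAlgebra = record
      { isBoundedLattice = record
        { isLattice = record
          { isPartialOrder = record
            { isPreorder = record
              { isEquivalence = record
                { refl  = id , id
                ; sym   = λ (p , q) → q , p
                ; trans = λ (p , q) (r , s) → (λ x → r (p x)) , (λ x → q (s x))
                }
              ; reflexive = proj₁
              ; trans     = λ p q x → q (p x)
              }
            ; antisym = _,_
            }
          ; supremum = λ a b → inj₁ , inj₂ , λ c p q → [ p , q ]′
          ; infimum  = λ a b → proj₁ , proj₂ , λ c p q x → p x , q x
          }
        ; maximum = λ a _ → tt
        ; minimum = λ a ()
        }
      ; exponential = λ c a b →
          (λ h x∈c u u≤x u∈a → h (decreasing c u≤x x∈c , u∈a)) ,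
          (λ h (x∈c , x∈a) → h x∈c _ P.refl x∈a)
      }
    }

-- Subset n is the powerset of {P₁,…,Pₙ}.
module GenericModel (n : ℕ) where

  -- w β Y is the point w_{β,Y}; the finite set Y is given by a list of its
  -- elements (every K^d is finite), and hence points are compared by _≋_, which
  -- ignores the order and the repetitions in these lists.
  data Point : Set where
    w : (β : Subset n) (Y : List Point) → Point

  val : Point → Subset n
  val (w β Y) = β

  below : Point → List Point
  below (w β Y) = Y

  infix 4 _≋_ _∈ₗ_ _≼_

  data _≋_ : Rel Point 0ℓ where
    w : ∀ {β β′ Y Y′} → β ≡ β′ →
        All (λ y → Any (y ≋_) Y′) Y → All (λ y → Any (y ≋_) Y) Y′ →
        w β Y ≋ w β′ Y′

  _∈ₗ_ : Point → List Point → Set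
  u ∈ₗ Y = Any (u ≋_) Y

  _≼_ : Rel Point 0ℓ
  u ≼ v = u ∈ₗ below v ⊎ u ≋ v

  -- The conditions on (β , Y) for w β Y to be a point of K^d ∖ K^{d-1}, where
  -- K⁻ = K^{d-1} and Old Y says that Y ⊆ K^{d-2} (nothing is old for d = 0).
  record Admissible (K⁻ : Pred Point 0ℓ) (Old : Pred (List Point) 0ℓ) (v : Point) : Set where
    private
      β = val v
      Y = below v
    field
      Y⊆K⁻        : All K⁻ Y
      Y-decreasing : ∀ {s t} → s ∈ K⁻ → s ≼ t → t ∈ₗ Y → s ∈ₗ Y
      Y-new        : ¬ Old Y
      β⊆val       : ∀ t → t ∈ₗ Y → β Subset.⊆ val t
      β≢val       : ∀ t → t ∈ K⁻ → (∀ s → s ∈ K⁻ → s ∈ₗ Y ⇔ s ≼ t) → β ≢ val t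

  -- K< d is K^{d-1}.
  mutual
    K< : ℕ → Pred Point 0ℓ
    K< zero      = ∅
    K< (ℕ.suc d) = K< d ∪ Admissible (K< d) (Old d)

    Old : ℕ → Pred (List Point) 0ℓ
    Old zero      Y = ⊥
    Old (ℕ.suc d) Y = All (K< d) Y

  K^ : ℕ → Pred Point 0ℓ
  K^ d = K< (ℕ.suc d)

  mutual
    ≋-refl : ∀ {u} → u ≋ u
    ≋-refl {w β Y} = w refl (⊆ₗ-refl Y) (⊆ₗ-refl Y)

    ⊆ₗ-refl : ∀ Y → All (_∈ₗ Y) Y
    ⊆ₗ-refl []      = []
    ⊆ₗ-refl (y ∷ Y) = here ≋-refl ∷ All.map there (⊆ₗ-refl Y)

  ≋-sym : ∀ {u v} → u ≋ v → v ≋ u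
  ≋-sym (w eq p q) = w (sym eq) q p

  mutual
    ≋-trans : ∀ {t u v} → t ≋ u → u ≋ v → t ≋ v
    ≋-trans (w eq p q) (w eq′ p′ q′) = w (trans eq eq′) (⊆ₗ-trans p p′) (⊆ₗ-trans q′ q)

    ⊆ₗ-trans : ∀ {X Y Z} → All (_∈ₗ Y) X → All (_∈ₗ Z) Y → All (_∈ₗ Z) X
    ⊆ₗ-trans []      q = []
    ⊆ₗ-trans (p ∷ ps) q = ∈ₗ-⊆ₗ p q ∷ ⊆ₗ-trans ps q

    ∈ₗ-⊆ₗ : ∀ {x Y Z} → x ∈ₗ Y → All (_∈ₗ Z) Y → x ∈ₗ Z
    ∈ₗ-⊆ₗ (here p)  (q ∷ qs) = ≋-∈ₗ p q
    ∈ₗ-⊆ₗ (there p) (q ∷ qs) = ∈ₗ-⊆ₗ p qs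

    ≋-∈ₗ : ∀ {x y Z} → x ≋ y → y ∈ₗ Z → x ∈ₗ Z
    ≋-∈ₗ p (here q)  = here (≋-trans p q)
    ≋-∈ₗ p (there q) = there (≋-∈ₗ p q)

  val-cong : ∀ {u v} → u ≋ v → val u ≡ val v
  val-cong (w eq _ _) = eq

  below-⊆ : ∀ {t u v} → u ≋ v → t ∈ₗ below u → t ∈ₗ below v
  below-⊆ (w _ p _) t∈ = ∈ₗ-⊆ₗ t∈ p

  ≼-respˡ : ∀ {t u v} → t ≋ u → u ≼ v → t ≼ v
  ≼-respˡ e = [ inj₁ ∘ ≋-∈ₗ e , inj₂ ∘ ≋-trans e ]′

  ≼-respʳ : ∀ {t u v} → u ≋ v → t ≼ u → t ≼ v
  ≼-respʳ e = [ inj₁ ∘ below-⊆ e , (λ p → inj₂ (≋-trans p e)) ]′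

  All-∈ₗ : ∀ {P : Pred Point 0ℓ} {t Y} → P Respects _≋_ → All P Y → t ∈ₗ Y → P t
  All-∈ₗ resp (p ∷ _)  (here e)  = resp (≋-sym e) p
  All-∈ₗ resp (_ ∷ ps) (there e) = All-∈ₗ resp ps e

  All-below : ∀ {P : Pred Point 0ℓ} {u v} → P Respects _≋_ → u ≋ v → All P (below u) → All P (below v)
  All-below resp (w _ _ q) ps = All.map (All-∈ₗ resp ps) q

  mutual
    K<-resp : ∀ d → K< d Respects _≋_
    K<-resp (ℕ.suc d) e (inj₁ p) = inj₁ (K<-resp d e p)
    K<-resp (ℕ.suc d) {u} {v} e (inj₂ p) = inj₂ (record
      { Y⊆K⁻        = All-below (K<-resp d) e Y⊆K⁻
      ; Y-decreasing = λ s∈ s≼t t∈ → below-⊆ e (Y-decreasing s∈ s≼t (below-⊆ e⁻ t∈))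
      ; Y-new        = λ old → Y-new (Old-resp d e⁻ old)
      ; β⊆val       = λ t t∈Y → subst (Subset._⊆ val t) (val-cong e) (β⊆val t (below-⊆ e⁻ t∈Y))
      ; β≢val       = λ t t∈K gen eq → β≢val t t∈K
          (λ s s∈K → mk⇔ (Equivalence.to (gen s s∈K) ∘ below-⊆ e)
                          (below-⊆ e⁻ ∘ Equivalence.from (gen s s∈K)))
          (trans (val-cong e) eq)
      })
      where
      open Admissible p
      e⁻ = ≋-sym e

    Old-resp : ∀ d {u v} → u ≋ v → Old d (below u) → Old d (below v)
    Old-resp (ℕ.suc d) e old = All-below (K<-resp d) e old

  K<-below : ∀ d {u v} → u ∈ K< d → v ∈ₗ below u → v ∈ K< d
  K<-below (ℕ.suc d) (inj₁ p) v∈ = inj₁ (K<-below d p v∈)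
  K<-below (ℕ.suc d) (inj₂ p) v∈ = inj₁ (All-∈ₗ (K<-resp d) (Admissible.Y⊆K⁻ p) v∈)

  below-trans : ∀ d {t u v} → v ∈ K< d → t ∈ₗ below u → u ∈ₗ below v → t ∈ₗ below v
  below-trans (ℕ.suc d) (inj₁ p) t∈ u∈ = below-trans d p t∈ u∈
  below-trans (ℕ.suc d) (inj₂ p) t∈ u∈ =
    Y-decreasing (K<-below d (All-∈ₗ (K<-resp d) Y⊆K⁻ u∈) t∈) (inj₁ t∈) u∈
    where open Admissible p

  mutual
    below-irrefl : ∀ u → ¬ u ∈ₗ below u
    below-irrefl (w β Y) u∈ = below-irrefl′ Y u∈ u∈

    below-irrefl′ : ∀ Y {u} → u ∈ₗ Y → ¬ u ∈ₗ below u
    below-irrefl′ (y ∷ Y) (here e)  u∈ = below-irrefl y (≋-∈ₗ (≋-sym e) (below-⊆ e u∈))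
    below-irrefl′ (y ∷ Y) (there p) u∈ = below-irrefl′ Y p u∈

  K : Poset 0ℓ 0ℓ 0ℓ
  K = record
    { Carrier = ∃ λ u → ∃ λ d → u ∈ K^ d
    ; _≈_ = λ u v → proj₁ u ≋ proj₁ v
    ; _≤_ = λ u v → proj₁ u ≼ proj₁ v
    ; isPartialOrder = record
      { isPreorder = record
        { isEquivalence = record { refl = ≋-refl ; sym = ≋-sym ; trans = ≋-trans }
        ; reflexive     = inj₂
        ; trans         = λ {t u v} → ≼-trans {t} {u} {v}
        }
      ; antisym = λ {u v} → ≼-antisym {u} {v}
      }
    }
    where
    ≼-trans : ∀ {t u v : ∃ λ x → ∃ λ d → x ∈ K^ d} →
              proj₁ t ≼ proj₁ u → proj₁ u ≼ proj₁ v → proj₁ t ≼ proj₁ v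
    ≼-trans {v = _ , d , v∈} (inj₁ p) (inj₁ q) = inj₁ (below-trans (ℕ.suc d) v∈ p q)
    ≼-trans p        (inj₂ q) = ≼-respʳ q p
    ≼-trans (inj₂ p) q        = ≼-respˡ p q

    ≼-antisym : ∀ {u v : ∃ λ x → ∃ λ d → x ∈ K^ d} →
                proj₁ u ≼ proj₁ v → proj₁ v ≼ proj₁ u → proj₁ u ≋ proj₁ v
    ≼-antisym (inj₂ p) _        = p
    ≼-antisym (inj₁ p) (inj₂ q) = ≋-sym q
    ≼-antisym {v = _ , d , v∈} (inj₁ p) (inj₁ q) = ⊥-elim (below-irrefl _ (below-trans (ℕ.suc d) v∈ q p))

  data KripkeSymbol : Set where
    order     : KripkeSymbol
    valuation : (I : Subset n) → KripkeSymbol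

  ℒK : Signature
  ℒK = record
    { FunSym   = ⊥
    ; RelSym   = KripkeSymbol
    ; funArity = λ ()
    ; relArity = λ { order → 2 ; (valuation I) → 1 }
    }

  𝔎 : Structure ℒK 0ℓ 0ℓ
  𝔎 = record
    { Carrier       = Poset.Carrier K
    ; _≈_           = Poset._≈_ K
    ; isEquivalence = Poset.isEquivalence K
    ; fun           = λ ()
    ; fun-cong      = λ ()
    ; Rel⟦_⟧        = λ where
        order         xs → Poset._≤_ K (xs zero) (xs (suc zero))
        (valuation I) xs → val (proj₁ (xs zero)) ≡ I
    ; rel-resp      = λ where
        order         eq → ≼-respˡ (≋-sym (eq zero)) ∘ ≼-respʳ (eq (suc zero))
        (valuation I) eq → trans (sym (val-cong (eq zero)))
    }

  F̂ : Structure ℒHA (lsuc 0ℓ) 0ℓ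
  F̂ = heytingStructure (𝓞↓ K)

  Piece : ℕ → Pred (Poset.Carrier K) 0ℓ
  Piece i u = proj₁ u ∈ K^ i

  preGenerator : Fin n → DownSet K
  preGenerator i = record
    { set        = λ u → proj₁ u ≋ w ⁅ i ⁆ []
    ; decreasing = λ u≤v v≈ → atomic (≼-respʳ v≈ u≤v)
    }
    where
    atomic : ∀ {u} → u ≼ w ⁅ i ⁆ [] → u ≋ w ⁅ i ⁆ []
    atomic (inj₂ e) = e

  Differ : DownSet K → DownSet K → Pred ℕ 0ℓ
  Differ a b i = ¬ (DownSet.set a ∩ Piece i ≐ DownSet.set b ∩ Piece i)

  IsMin : Pred ℕ 0ℓ → Pred ℕ 0ℓ
  IsMin S i = i ∈ S × (∀ j → j ∈ S → i ℕ.≤ j)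

  2^-_ : ℕ → ℚ
  2^- i = (+ 1) ℚ./ (2 ℕ.^ i)
    where instance _ = m^n≢0 2 i

  module Classical (em : ∀ {ℓ} → ExcludedMiddle ℓ) where

    -- A nonempty set of naturals has a minimum, so the case no is 2^(- min ∅) = 0.
    dist : DistanceFunction (DownSet K)
    dist a b with em {P = ∃ (IsMin (Differ a b))}
    ... | yes (i , _) = 2^- i
    ... | no  _       = 0ℚ

    -- Positive rational radii suffice for topological density.
    record IsDense {h} (H : Pred (DownSet K) h) : Set (lsuc 0ℓ ⊔ h) where
      field
        isSubalgebra : IsSubalgebra F̂ H
        approximate  : ∀ a ε → 0ℚ ℚ.< ε → ∃ λ b → b ∈ H × dist a b ℚ.< ε

{-# OPTIONS --safe #-}
module Submission where

-- The points p of K correspond to the sets ↓ p, and these are the elements z of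
-- H with a largest c < z: if p ∈ z ∖ c, then ↓ p ∈ H lies below z but not below
-- c, so z = ↓ p and c = ↓ p ∖ {p}. This uses that H contains every finite
-- decreasing set a: if a ⊆ K^d, then a is determined by its trace on K^{d+1},
-- because a point above level d + 1 lies above one of level exactly d + 1.
--
-- The valuation is read off the number of points with a given set strictly
-- below them. Let S = {a_i} ∪ ↓ x. If P_i ∈ val x, then w_{∅,S} exists and, unless
-- S = ↓ x, so does w_{{P_i},S}. If P_i ∉ val x, then at most w_{∅,S} exists, and
-- not even that when S = ↓ x: then val x ⊆ val a_i = {P_i}, hence val x = ∅.

open import Defs
open import Axiom.ExcludedMiddle using (ExcludedMiddle)
open import Axiom.DoubleNegationElimination using (em⇒dne)
open import Level using (0ℓ; lift; lower; _⊔_) renaming (suc to lsuc)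
open import Data.Empty using (⊥-elim)
open import Data.Fin using (Fin; zero; suc; _↑ˡ_; _↑ʳ_)
open import Data.Fin.Subset as Subset using (Subset; ⁅_⁆)
open import Data.Fin.Subset.Properties
  using (_∈?_; ⊆-antisym; ⊥⊆; ∉⊥; x∈⁅x⁆; x∈⁅y⁆⇒x≡y; Empty-unique; nonempty?)
open import Data.Integer as ℤ using (+_)
import Data.Integer.Properties as ℤ
open import Data.List using (List; []; _∷_)
open import Data.List.Membership.Propositional using (find)
open import Data.List.Relation.Unary.All as All using (All; []; _∷_)
open import Data.List.Relation.Unary.All.Properties using (¬All⇒Any¬)
open import Data.List.Relation.Unary.Any as Any using (here; there)
open import Data.Nat as ℕ using (ℕ; _≥_; zero; suc)
open import Data.Nat.Induction using (<-rec)
import Data.Nat.Properties as ℕ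
open import Data.Product using (Σ; ∃; ∃₂; _×_; _,_; proj₁; proj₂)
open import Data.Rational as ℚ using (0ℚ)
import Data.Rational.Properties as ℚ
import Data.Rational.Unnormalised as ℚᵘ
import Data.Rational.Unnormalised.Properties as ℚᵘ
open import Data.Sum as Sum using (_⊎_; inj₁; inj₂)
open import Data.Vec.Functional as Vector using (Vector)
open import Data.Vec.Functional.Properties using (lookup-++ˡ; lookup-++ʳ)
open import Function using (id; _∘_; _⇔_; mk⇔; Equivalence)
import Function.Properties.Equivalence as ⇔
open import Relation.Binary using (Poset)
open import Relation.Binary.PropositionalEquality using (_≡_; _≢_; refl; sym; trans; subst)
open import Relation.Nullary using (¬_; Dec; yes; no)
open import Relation.Unary using (Pred; _∈_; _⊆_; _∩_; _∪_; _≐_)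

open Equivalence using (to; from)

-- Among unnormalised rationals the inequality is a cross-multiplication, 1 · m ≤ 1 · n, with no
-- reduction by a gcd to follow.
1/-antimono-≤ : ∀ m n .{{_ : ℕ.NonZero m}} .{{_ : ℕ.NonZero n}} → m ℕ.≤ n → + 1 ℚ./ n ℚ.≤ + 1 ℚ./ m
1/-antimono-≤ (suc m) (suc n) m≤n = ℚ.toℚᵘ-cancel-≤
  (ℚᵘ.≤-respˡ-≃ (ℚᵘ.≃-sym (ℚ.toℚᵘ-fromℚᵘ (ℚᵘ.mkℚᵘ (+ 1) n)))
  (ℚᵘ.≤-respʳ-≃ (ℚᵘ.≃-sym (ℚ.toℚᵘ-fromℚᵘ (ℚᵘ.mkℚᵘ (+ 1) m)))
  (ℚᵘ.*≤* (ℤ.*-monoˡ-≤-nonNeg (+ 1) (ℤ.+≤+ m≤n)))))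

-- Formulas for the order, lower covers and the valuation

infix 7 _⊑′_ _⋖′_

-- `ℒHA` has no order symbol, so the order is expressed by the meet.
_⊑′_ : ∀ {k} → Fin k → Fin k → Formula ℒHA k
i ⊑′ j = app ⊓ʰ (var i Vector.∷ var j Vector.∷ Vector.[]) ≈′ var i

-- Makes `c` the largest element strictly below `z`.
_⋖′_ : ∀ {k} → Fin k → Fin k → Formula ℒHA k
c ⋖′ z = c ⊑′ z ∧′ (z ⊑′ c ⇒′ ⊥′) ∧′
         ∀′ (zero ⊑′ suc z ⇒′ suc z ⊑′ zero ∨′ zero ⊑′ suc c)

-- For `a` the pre-generator a_i and `x` the set ↓ p, this expresses P_i ∈ val p. Two elements must
-- have the join of `a` and `x` as lower cover. They may be equal only if `a` lies below `x`, so one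
-- formula serves both cases of the count.
valued′ : ∀ {k} → Fin k → Fin k → Formula ℒHA k
valued′ a x = ∃′ (
  var zero ≈′ app ⊔ʰ (var (suc a) Vector.∷ var (suc x) Vector.∷ Vector.[]) ∧′
  ∃′ (∃′ (suc (suc zero) ⋖′ suc zero ∧′ suc (suc zero) ⋖′ zero ∧′
          (var (suc zero) ≈′ var zero ⇒′ suc (suc (suc a)) ⊑′ suc (suc (suc x))))))

⋀′ : ∀ {m k} → Vector (Formula ℒHA k) m → Formula ℒHA k
-- `⊥′ ⇒′ ⊥′` serves as truth.
⋀′ {zero}  φs = ⊥′ ⇒′ ⊥′
⋀′ {suc m} φs = φs zero ∧′ ⋀′ (φs ∘ suc)

literal′ : ∀ {p k} {P : Set p} → Dec P → Formula ℒHA k → Formula ℒHA k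
literal′ (yes _) φ = φ
literal′ (no _)  φ = φ ⇒′ ⊥′

module _ {c ℓ} (A : Structure ℒHA c ℓ) where

  ⋀′-⇔ : ∀ {m k} (ρ : Vector (Structure.Carrier A) k) (φs : Vector (Formula ℒHA k) m) →
         _⊨_ A ρ (⋀′ φs) ⇔ (∀ i → _⊨_ A ρ (φs i))
  ⋀′-⇔ {zero}  ρ φs = mk⇔ (λ _ ()) (λ _ → id)
  ⋀′-⇔ {suc m} ρ φs = mk⇔
    (λ { (p , ps) zero → p ; (p , ps) (suc i) → to (⋀′-⇔ ρ (φs ∘ suc)) ps i })
    (λ ps → ps zero , from (⋀′-⇔ ρ (φs ∘ suc)) (ps ∘ suc))

  literal′-⇔ : ∀ {p k} {P : Set p} (ρ : Vector (Structure.Carrier A) k) (P? : Dec P) φ →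
               _⊨_ A ρ (literal′ P? φ) ⇔ (_⊨_ A ρ φ ⇔ P)
  literal′-⇔ ρ (yes p) φ = mk⇔ (λ t → mk⇔ (λ _ → p) (λ _ → t)) (λ e → from e p)
  literal′-⇔ ρ (no ¬p) φ = mk⇔ (λ f → mk⇔ (⊥-elim ∘ lower ∘ f) (⊥-elim ∘ ¬p))
                             (λ e t → ⊥-elim (¬p (to e t)))

module _ (n : ℕ) (em : ∀ {ℓ} → ExcludedMiddle ℓ) where
  open GenericModel n
  open Classical em
  open DownSet

  -- The metric and agreement on finite pieces

  least : ∀ (S : Pred ℕ 0ℓ) m → m ∈ S → ∃ (IsMin S)
  least S = <-rec (λ m → m ∈ S → ∃ (IsMin S)) step
    where
    step : ∀ m → (∀ {j} → j ℕ.< m → j ∈ S → ∃ (IsMin S)) → m ∈ S → ∃ (IsMin S)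
    step m rec m∈ with em {P = ∃ λ j → j ℕ.< m × j ∈ S}
    ... | yes (j , j<m , j∈) = rec j<m j∈
    ... | no  ∄j             = m , m∈ , λ j j∈ → ℕ.≮⇒≥ (λ j<m → ∄j (j , j<m , j∈))

  2^-positive : ∀ i → 0ℚ ℚ.< 2^- i
  2^-positive i = ℚ.positive⁻¹ (2^- i) {{ℚ.normalize-pos 1 (2 ℕ.^ i)}}
    where instance _ = ℕ.m^n≢0 2 i

  2^-antimono-≤ : ∀ {i j} → i ℕ.≤ j → 2^- j ℚ.≤ 2^- i
  2^-antimono-≤ {i} {j} i≤j = 1/-antimono-≤ (2 ℕ.^ i) (2 ℕ.^ j) (ℕ.^-monoʳ-≤ 2 i≤j)
    where instance _ = ℕ.m^n≢0 2 i
                   _ = ℕ.m^n≢0 2 j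

  -- If the traces on `K^ i` differed, the least j at which they differ would satisfy j ≤ i, and the
  -- distance 2^-j would be at least 2^-i.
  dist<⇒agree : ∀ a b i → dist a b ℚ.< 2^- i → set a ∩ Piece i ≐ set b ∩ Piece i
  dist<⇒agree a b i dist< = em⇒dne em (λ differ → absurd differ dist<)
    where
    absurd : Differ a b i → ¬ dist a b ℚ.< 2^- i
    absurd differ with em {P = ∃ (IsMin (Differ a b))}
    ... | yes (j , _ , j≤) = λ lt → ℚ.<-irrefl refl (ℚ.<-≤-trans lt (2^-antimono-≤ (j≤ i differ)))
    -- The default distance 0 cannot arise: `i` is a member of the set, which therefore has a
    -- minimum.
    ... | no  ∄min         = λ _ → ∄min (least (Differ a b) i differ)

  -- Principal decreasing sets and the levels of K

  Pt : Set
  Pt = Poset.Carrier K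

  ↓ : Pt → DownSet K
  ↓ p = record
    { set        = λ u → proj₁ u ≼ proj₁ p
    ; decreasing = λ {u} {v} → Poset.trans K {u} {v} {p}
    }

  -- By `below-irrefl` this is ↓ p without p.
  ↓° : Pt → DownSet K
  ↓° p@(_ , d , p∈) = record
    { set        = λ u → proj₁ u ∈ₗ below (proj₁ p)
    ; decreasing = λ { (inj₁ u<v) v<p → below-trans (suc d) p∈ u<v v<p
                     ; (inj₂ u≋v) v<p → ≋-∈ₗ u≋v v<p }
    }

  K<-mono : ∀ {d e} → d ℕ.≤ e → K< d ⊆ K< e
  K<-mono d≤e = go (ℕ.≤⇒≤′ d≤e)
    where
    go : ∀ {d e} → d ℕ.≤′ e → K< d ⊆ K< e
    go ℕ.≤′-refl       = id
    go (ℕ.≤′-step d≤e) = inj₁ ∘ go d≤e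

  K<-≼ : ∀ d {u v} → v ∈ K< d → u ≼ v → u ∈ K< d
  K<-≼ d v∈ (inj₁ u<v) = K<-below d v∈ u<v
  K<-≼ d v∈ (inj₂ u≋v) = K<-resp d (≋-sym u≋v) v∈

  val-antitone : ∀ d {u v} → v ∈ K< d → u ≼ v → val v Subset.⊆ val u
  val-antitone d       v∈        (inj₂ u≋v) = subst (_ Subset.∈_) (sym (val-cong u≋v))
  val-antitone (suc d) (inj₁ v∈) (inj₁ u<v) = val-antitone d v∈ (inj₁ u<v)
  val-antitone (suc d) (inj₂ ad) (inj₁ u<v) = Admissible.β⊆val ad _ u<v

  -- Condition (iii) freed of levels. At the level where `v` = w_{β,Y} enters, Y is decreasing, so
  -- an upper bound `t` of Y that lies in Y generates it.
  val-≢-lower-cover : ∀ d {t v} → v ∈ K< d → t ∈ₗ below v →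
                      (∀ (s : Pt) → proj₁ s ∈ₗ below v → proj₁ s ≼ t) → val v ≢ val t
  val-≢-lower-cover (suc d) (inj₁ v∈) t<v top = val-≢-lower-cover d v∈ t<v top
  val-≢-lower-cover (suc d) {t} v∈@(inj₂ ad) t<v top = β≢val t
    (All-∈ₗ (K<-resp d) Y⊆K⁻ t<v)
    (λ s s∈ → mk⇔ (top (s , d , inj₁ s∈)) (λ s≼t → Y-decreasing s∈ s≼t t<v))
    where open Admissible ad

  -- Each level above d is reached only through level d, since Y ⊈ K^{d-1} for
  -- the points w_{β,Y} of K^{d+1} ∖ K^d.
  descend : ∀ e d {v} → v ∈ K< e → ¬ v ∈ K< d → ∃ λ u → u ≼ v × u ∈ K< (suc d) × ¬ u ∈ K< d
  descend (suc e) d (inj₁ v∈) v∉ = descend e d v∈ v∉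
  descend (suc e) d v∈@(inj₂ ad) v∉ with e ℕ.≤? d
  ... | yes e≤d = _ , inj₂ ≋-refl , K<-mono (ℕ.s≤s e≤d) v∈ , v∉
  descend (suc zero)    d v∈ v∉ | no e≰d = ⊥-elim (e≰d ℕ.z≤n)
  descend (suc (suc e)) d {v} v∈@(inj₂ ad) v∉ | no e≰d =
    let y , y∈Y′ , y∉  = find (¬All⇒Any¬ (λ _ → em) (below v) Y-new)
        y∈Y            = Any.map (λ { refl → ≋-refl }) y∈Y′
        y∈             = All-∈ₗ (K<-resp (suc e)) Y⊆K⁻ y∈Y
        u , u≼y , u∈   = descend (suc e) d y∈ (y∉ ∘ K<-mono (ℕ.s≤s⁻¹ (ℕ.≰⇒> e≰d)))
    in  u , inj₁ (lower-closed y∈ u≼y y∈Y) , u∈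
    where
    open Admissible ad
    lower-closed : ∀ {u y} → y ∈ K< (suc e) → u ≼ y → y ∈ₗ below v → u ∈ₗ below v
    lower-closed y∈ u≼y = Y-decreasing (K<-≼ (suc e) y∈ u≼y) u≼y

  agree⇒≐ : ∀ (a b : DownSet K) d → set a ⊆ Piece d →
            set a ∩ Piece (suc d) ≐ set b ∩ Piece (suc d) → set b ≐ set a
  agree⇒≐ a b d a⊆ (a⊆b , b⊆a) = b⊆ , λ {u} u∈a → proj₁ (a⊆b {u} (u∈a , inj₁ (a⊆ u∈a)))
    where
    b⊆ : set b ⊆ set a
    b⊆ {v , e , v∈} v∈b with em {P = v ∈ K^ d}
    ... | yes v∈K^d = proj₁ (b⊆a {v , e , v∈} (v∈b , inj₁ v∈K^d))
    ... | no  v∉K^d =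
      -- Since `K< (suc d)` is `K^ d`, the point `u` has level exactly d + 1. It lies in `b`, hence
      -- by agreement in `a`, against a ⊆ K^d.
      let u , u≼v , u∈ , u∉ = descend (suc e) (suc d) v∈ v∉K^d
          p : Pt
          p = u , suc d , u∈
      in  ⊥-elim (u∉ (a⊆ {p} (proj₁ (b⊆a {p} (decreasing b u≼v v∈b , u∈)))))

  -- Existence and uniqueness of points with a given set below them

  Decreasing : Pred Point 0ℓ → Pred (List Point) 0ℓ
  Decreasing K⁻ Y = ∀ {s t} → s ∈ K⁻ → s ≼ t → t ∈ₗ Y → s ∈ₗ Y

  -- The newness condition selects the level: `d` is lowered as long as Y fits into the preceding
  -- piece, and where this stops w_{β,Y} is a new point.
  exists-point : ∀ d β Y → All (K< d) Y → Decreasing (K< d) Y →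
                 (∀ t → t ∈ₗ Y → β Subset.⊆ val t) →
                 (∀ t → t ∈ₗ Y → (∀ s → s ∈ₗ Y → s ≼ t) → β ≢ val t) →
                 ∃ λ e → w β Y ∈ K^ e
  exists-point d β Y Y⊆ decr β⊆ β≢ = go d Y⊆ decr
    where
    admissible : ∀ d → All (K< d) Y → Decreasing (K< d) Y → ¬ Old d Y →
                 Admissible (K< d) (Old d) (w β Y)
    admissible d Y⊆ decr new = record
      { Y⊆K⁻         = Y⊆
      ; Y-decreasing = decr
      ; Y-new        = new
      ; β⊆val        = β⊆
      -- A generator of Y belongs to Y and is its largest element.
      ; β≢val        = λ t t∈ gen → β≢ t (from (gen t t∈) (inj₂ ≋-refl))
          (λ s s∈Y → to (gen s (All-∈ₗ (K<-resp d) Y⊆ s∈Y)) s∈Y)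
      }
    go : ∀ d → All (K< d) Y → Decreasing (K< d) Y → ∃ λ e → w β Y ∈ K^ e
    -- Newness is void at the bottom, where `Old zero Y` is `⊥`.
    go zero    Y⊆ decr = zero , inj₂ (admissible zero Y⊆ decr id)
    go (suc d) Y⊆ decr with em {P = All (K< d) Y}
    ... | yes Y⊆′ = go d Y⊆′ (λ s∈ → decr (inj₁ s∈))
    ... | no  new = suc d , inj₂ (admissible (suc d) Y⊆ decr new)

  atom∈K^ : ∀ i d → w ⁅ i ⁆ [] ∈ K^ d
  atom∈K^ i zero    = inj₂ record
    { Y⊆K⁻ = [] ; Y-decreasing = λ () ; Y-new = λ () ; β⊆val = λ _ () ; β≢val = λ _ () }
  atom∈K^ i (suc d) = inj₁ (atom∈K^ i d)

  ≼-atom⇒≋ : ∀ {i u} → u ≼ w ⁅ i ⁆ [] → u ≋ w ⁅ i ⁆ []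
  ≼-atom⇒≋ (inj₂ u≋) = u≋

  -- Comparing the sets on points of K suffices, because all entries of the list of such a point are
  -- themselves in K (`K<-below`).
  ≋⇐below : ∀ (p q : Pt) → val (proj₁ p) ≡ val (proj₁ q) → set (↓° p) ≐ set (↓° q) → proj₁ p ≋ proj₁ q
  ≋⇐below p@(w β Y , d , p∈) q@(w γ Z , e , q∈) β≡γ (p⊆q , q⊆p) =
    w β≡γ (sub d p∈ (λ {u} → p⊆q {u})) (sub e q∈ (λ {u} → q⊆p {u}))
    where
    sub : ∀ {β} {Y} d → w β Y ∈ K^ d → ∀ {Z} →
          (λ (u : Pt) → proj₁ u ∈ₗ Y) ⊆ (λ u → proj₁ u ∈ₗ Z) → All (_∈ₗ Z) Y
    sub {Y = Y} d p∈ Y⊆Z = All.map (λ {y} y∈Y → Y⊆Z {y , d , K<-below (suc d) p∈ y∈Y} y∈Y) (⊆ₗ-refl Y)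

  -- Reading the valuation off the points above a join

  join : Fin n → Pt → Pred Pt 0ℓ
  join i x = set (preGenerator i) ∪ set (↓ x)

  -- The two points may coincide, but only if S = ↓ x.
  Twins : Fin n → Pt → Set
  Twins i x = ∃₂ λ p q → set (↓° p) ≐ join i x × set (↓° q) ≐ join i x ×
                         (proj₁ p ≋ proj₁ q → w ⁅ i ⁆ [] ≼ proj₁ x)

  val-spec : ∀ i (x : Pt) → i Subset.∈ val (proj₁ x) ⇔ Twins i x
  val-spec i x̂@(x , d , x∈) = mk⇔ forth back
    where
    a : Point
    a = w ⁅ i ⁆ []

    Y : List Point
    Y = a ∷ x ∷ below x

    split : ∀ {t} → t ∈ₗ Y → t ≋ a ⊎ t ≼ x
    split (here t≋a)          = inj₁ t≋a
    split (there (here t≋x))  = inj₂ (inj₂ t≋x)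
    split (there (there t<x)) = inj₂ (inj₁ t<x)

    unsplit : ∀ {t} → t ≋ a ⊎ t ≼ x → t ∈ₗ Y
    unsplit (inj₁ t≋a)        = here t≋a
    unsplit (inj₂ (inj₂ t≋x)) = there (here t≋x)
    unsplit (inj₂ (inj₁ t<x)) = there (there t<x)

    Y⊆ : All (K^ d) Y
    Y⊆ = atom∈K^ i d ∷ x∈ ∷ All.map (K<-below (suc d) x∈) (⊆ₗ-refl (below x))

    decr : Decreasing (K^ d) Y
    decr {s} {t} s∈ s≼t t∈ with split t∈
    ... | inj₁ t≋a = unsplit (inj₁ (≼-atom⇒≋ (≼-respʳ t≋a s≼t)))
    ... | inj₂ t≼x = unsplit (inj₂ (Poset.trans K {s , d , s∈} {t , d , K<-≼ (suc d) x∈ t≼x} {x̂} s≼t t≼x))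

    i∈val : ∀ {t} → i Subset.∈ val x → t ∈ₗ Y → i Subset.∈ val t
    i∈val i∈ t∈ with split t∈
    ... | inj₁ t≋a = subst (i Subset.∈_) (sym (val-cong t≋a)) (x∈⁅x⁆ i)
    ... | inj₂ t≼x = val-antitone (suc d) x∈ t≼x i∈

    -- Every point of S has P_i in its value, so ∅ is none of these values and condition (iii)
    -- holds.
    p∈ : i Subset.∈ val x → ∃ λ e → w Subset.⊥ Y ∈ K^ e
    p∈ i∈ = exists-point (suc d) Subset.⊥ Y Y⊆ decr (λ _ _ → ⊥⊆)
              (λ t t∈ _ ⊥≡ → ∉⊥ (subst (i Subset.∈_) (sym ⊥≡) (i∈val i∈ t∈)))

    forth : i Subset.∈ val x → Twins i x̂
    forth i∈ with em {P = a ≼ x}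
    ... | yes a≼x = (_ , p∈ i∈) , (_ , p∈ i∈) , (split , unsplit) , (split , unsplit) , λ _ → a≼x
    ... | no a⋠x = (_ , p∈ i∈) , (_ , q∈) , (split , unsplit) , (split , unsplit) ,
                   λ p≋q → ⊥-elim (∉⊥ (subst (i Subset.∈_) (sym (val-cong p≋q)) (x∈⁅x⁆ i)))
      where
      -- Without a largest element S is not generated by one point, and condition (iii) is vacuous
      -- for `⁅ i ⁆`. A largest element equal to `a` would force x = a by minimality of atoms; one
      -- below `x` would force a ≤ x.
      no-top : ∀ t → t ∈ₗ Y → ¬ (∀ s → s ∈ₗ Y → s ≼ t)
      no-top t t∈ top with split t∈
      ... | inj₁ t≋a = a⋠x (inj₂ (≋-sym (≼-atom⇒≋ (≼-respʳ t≋a (top x (there (here ≋-refl)))))))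
      ... | inj₂ t≼x = a⋠x (Poset.trans K {a , d , atom∈K^ i d} {t , d , K<-≼ (suc d) x∈ t≼x} {x̂}
                              (top a (here ≋-refl)) t≼x)
      q∈ : ∃ λ e → w ⁅ i ⁆ Y ∈ K^ e
      q∈ = exists-point (suc d) ⁅ i ⁆ Y Y⊆ decr
             (λ t t∈ j∈ → subst (Subset._∈ val t) (sym (x∈⁅y⁆⇒x≡y i j∈)) (i∈val i∈ t∈))
             (λ t t∈ top → ⊥-elim (no-top t t∈ top))

    back : Twins i x̂ → i Subset.∈ val x
    back (p̂@(p , e , p∈) , q̂@(q , f , q∈) , p° , q° , p≋q⇒a≼x) with em {P = a ≼ x}
    ... | yes a≼x with nonempty? (val x)
    ...   | yes (j , j∈) = subst (Subset._∈ val x) (x∈⁅y⁆⇒x≡y i (val-antitone (suc d) x∈ a≼x j∈)) j∈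
    -- Here `x` is the largest point strictly below `p`, and val p ⊆ val x = ∅ makes the two values
    -- equal, against condition (iii).
    ...   | no  empty    = ⊥-elim (val-≢-lower-cover (suc e) p∈ x<p top
                             (trans (Empty-unique (λ (j , j∈) → empty (j , val-antitone (suc e) p∈ (inj₁ x<p) j∈)))
                                    (sym (Empty-unique empty))))
      where
      x<p : x ∈ₗ below p
      x<p = proj₂ p° {x̂} (inj₂ (inj₂ ≋-refl))
      top : ∀ (s : Pt) → proj₁ s ∈ₗ below p → proj₁ s ≼ x
      top s s<p with proj₁ p° {s} s<p
      ... | inj₁ s≋a = ≼-respˡ s≋a a≼x
      ... | inj₂ s≼x = s≼x
    back (p̂ , q̂ , p° , q° , p≋q⇒a≼x) | no a⋠x with i ∈? val x
    ... | yes i∈ = i∈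
    -- Both points have value inside val x ∩ {P_i} = ∅ and the same points below them. So they
    -- coincide, which gives a ≤ x.
    ... | no  i∉ = ⊥-elim (a⋠x (p≋q⇒a≼x (≋⇐below p̂ q̂
                     (trans (Empty-unique (empty p̂ (λ {u} → proj₂ p° {u})))
                            (sym (Empty-unique (empty q̂ (λ {u} → proj₂ q° {u})))))
                     ( (λ {u} u<p → proj₂ q° {u} (proj₁ p° {u} u<p))
                     , (λ {u} u<q → proj₂ p° {u} (proj₁ q° {u} u<q))))))
      where
      empty : ∀ (r : Pt) → join i x̂ ⊆ set (↓° r) → Subset.Empty (val (proj₁ r))
      empty (r , e , r∈) S⊆ (j , j∈) = i∉ (subst (Subset._∈ val x) (x∈⁅y⁆⇒x≡y i j∈a) j∈x)
        where
        j∈x : j Subset.∈ val x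
        j∈x = val-antitone (suc e) r∈ (inj₁ (S⊆ {x̂} (inj₂ (inj₂ ≋-refl)))) j∈
        j∈a : j Subset.∈ ⁅ i ⁆
        j∈a = val-antitone (suc e) r∈ (inj₁ (S⊆ {a , d , atom∈K^ i d} (inj₁ ≋-refl))) j∈

  -- Finite sets, covers and valuation formulas in a dense subalgebra

  module DenseSubalgebra {h} (H : Pred (DownSet K) h) (dense : IsDense H) where
    open IsDense dense

    𝓐 : Structure ℒHA (lsuc 0ℓ ⊔ h) 0ℓ
    𝓐 = substructure F̂ isSubalgebra

    open Structure 𝓐 using (Carrier)

    abstract
      -- An element of `H` at distance less than 2^-(d+1) from `a` has the same trace on K^{d+1} and
      -- is therefore equal to `a`.
      finite∈H : ∀ (a : DownSet K) d → set a ⊆ Piece d → a ∈ H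
      finite∈H a d a⊆ =
        let b , b∈H , dist< = approximate a (2^- suc d) (2^-positive (suc d))
        in  IsSubalgebra.resp-≈ isSubalgebra (agree⇒≐ a b d a⊆ (dist<⇒agree a b (suc d) dist<)) b∈H

    preGenerator∈H : ∀ i → preGenerator i ∈ H
    preGenerator∈H i = finite∈H (preGenerator i) 0 λ u≋ → K<-resp 1 (≋-sym u≋) (atom∈K^ i 0)

    principal lowerCover : Pt → Carrier
    principal p@(_ , d , p∈)  = ↓ p , finite∈H (↓ p) d (K<-≼ (suc d) p∈)
    lowerCover p@(_ , d , p∈) = ↓° p , finite∈H (↓° p) d (K<-below (suc d) p∈)

    ⌊_⌋ : Carrier → Pred Pt 0ℓ
    ⌊ a , _ ⌋ = set a

    ⊑′-⇔ : ∀ {k} (ρ : Vector Carrier k) i j → _⊨_ 𝓐 ρ (i ⊑′ j) ⇔ (⌊ ρ i ⌋ ⊆ ⌊ ρ j ⌋)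
    ⊑′-⇔ ρ i j = mk⇔
      (λ (lift (_ , ⊇)) {_} u∈ → proj₂ (⊇ u∈))
      (λ i⊆j → lift ((λ {_} → proj₁) , λ {_} u∈ → u∈ , i⊆j u∈))

    IsPrincipal : Pt → (c z : Carrier) → Set
    IsPrincipal p c z = ⌊ z ⌋ ≐ set (↓ p) × ⌊ c ⌋ ≐ set (↓° p)

    Covers : (c z : Carrier) → Set (lsuc 0ℓ ⊔ h)
    Covers c z = ⌊ c ⌋ ⊆ ⌊ z ⌋ × ¬ ⌊ z ⌋ ⊆ ⌊ c ⌋ ×
                 (∀ t → ⌊ t ⌋ ⊆ ⌊ z ⌋ → (⌊ z ⌋ ⊆ ⌊ t ⌋) ⊎ (⌊ t ⌋ ⊆ ⌊ c ⌋))

    ⋖′-⇔-Covers : ∀ {k} (ρ : Vector Carrier k) c z → _⊨_ 𝓐 ρ (c ⋖′ z) ⇔ Covers (ρ c) (ρ z)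
    ⋖′-⇔-Covers ρ c z = mk⇔
      (λ (c⊑z , z⋢c , max) → to (⊑′-⇔ ρ c z) c⊑z , (λ z⊆c → lower (z⋢c (from (⊑′-⇔ ρ z c) z⊆c))) ,
         λ t t⊆z → Sum.map (to (⊑′-⇔ (t Vector.∷ ρ) (suc z) zero)) (to (⊑′-⇔ (t Vector.∷ ρ) zero (suc c)))
           (max t (from (⊑′-⇔ (t Vector.∷ ρ) zero (suc z)) t⊆z)))
      (λ (c⊆z , z⊈c , max) → from (⊑′-⇔ ρ c z) c⊆z , (λ z⊑c → ⊥-elim (z⊈c (to (⊑′-⇔ ρ z c) z⊑c))) ,
         λ t t⊑z → Sum.map (from (⊑′-⇔ (t Vector.∷ ρ) (suc z) zero)) (from (⊑′-⇔ (t Vector.∷ ρ) zero (suc c)))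
           (max t (to (⊑′-⇔ (t Vector.∷ ρ) zero (suc z)) t⊑z)))

    -- Maximality of `c` is tested on two finite elements of `H`. `principal p` contains `p`, so it
    -- is not below `c` and must contain `z`. `lowerCover p` omits `p`, so it does not contain `z`
    -- and must lie below `c`.
    Covers⇒IsPrincipal : ∀ c z → Covers c z → ∀ p → p ∈ ⌊ z ⌋ → ¬ p ∈ ⌊ c ⌋ → IsPrincipal p c z
    Covers⇒IsPrincipal c z (c⊆z , _ , max) p p∈z p∉c =
      ((λ {u} → z⊆↓p {u}) , λ {u} → ↓p⊆z {u}) , (λ {u} → c⊆↓°p {u}) , λ {u} → ↓°p⊆c {u}
      where
      ↓p⊆z : set (↓ p) ⊆ ⌊ z ⌋
      ↓p⊆z {u} u≼p = decreasing (proj₁ z) {u} {p} u≼p p∈z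
      z⊆↓p : ⌊ z ⌋ ⊆ set (↓ p)
      z⊆↓p {u} with max (principal p) (λ {u} → ↓p⊆z {u})
      ... | inj₁ z⊆ = z⊆ {u}
      ... | inj₂ ⊆c = ⊥-elim (p∉c (⊆c {p} (inj₂ ≋-refl)))
      ↓°p⊆c : set (↓° p) ⊆ ⌊ c ⌋
      ↓°p⊆c {u} with max (lowerCover p) (λ {u} u<p → ↓p⊆z {u} (inj₁ u<p))
      ... | inj₁ z⊆ = ⊥-elim (below-irrefl (proj₁ p) (z⊆ {p} p∈z))
      ... | inj₂ ⊆c = ⊆c {u}
      c⊆↓°p : ⌊ c ⌋ ⊆ set (↓° p)
      c⊆↓°p {u} u∈c with z⊆↓p {u} (c⊆z u∈c)
      ... | inj₁ u<p = u<p
      ... | inj₂ u≋p = ⊥-elim (p∉c (decreasing (proj₁ c) {p} {u} (inj₂ (≋-sym u≋p)) u∈c))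

    -- Forwards, any point of `z` outside `c` will do. Backwards, a decreasing subset of ↓ p either
    -- contains `p`, hence all of ↓ p, or consists of points strictly below `p`.
    Covers-⇔-IsPrincipal : ∀ c z → Covers c z ⇔ (∃ λ p → IsPrincipal p c z)
    Covers-⇔-IsPrincipal c z = mk⇔ forth back
      where
      forth : Covers c z → ∃ λ p → IsPrincipal p c z
      forth covers@(_ , z⊈c , _) =
        let p , p∈z , p∉c = em⇒dne em λ ∄p → z⊈c λ {u} u∈z → em⇒dne em λ u∉c → ∄p (u , u∈z , u∉c)
        in  p , Covers⇒IsPrincipal c z covers p p∈z p∉c

      back : (∃ λ p → IsPrincipal p c z) → Covers c z
      back (p , (z⊆ , ⊆z) , (c⊆ , ⊆c)) =
        (λ {u} u∈c → ⊆z {u} (inj₁ (c⊆ u∈c))) ,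
        (λ z⊆c → below-irrefl (proj₁ p) (c⊆ {p} (z⊆c (⊆z {p} (inj₂ ≋-refl))))) ,
        max
        where
        max : ∀ t → ⌊ t ⌋ ⊆ ⌊ z ⌋ → (⌊ z ⌋ ⊆ ⌊ t ⌋) ⊎ (⌊ t ⌋ ⊆ ⌊ c ⌋)
        max t t⊆z with em {P = p ∈ ⌊ t ⌋}
        ... | yes p∈t = inj₁ λ {u} u∈z → decreasing (proj₁ t) {u} {p} (z⊆ u∈z) p∈t
        ... | no  p∉t = inj₂ λ {u} u∈t → ⊆c {u} (strict u∈t)
          where
          strict : ⌊ t ⌋ ⊆ set (↓° p)
          strict {u} u∈t with z⊆ (t⊆z u∈t)
          ... | inj₁ u<p = u<p
          ... | inj₂ u≋p = ⊥-elim (p∉t (decreasing (proj₁ t) {p} {u} (inj₂ (≋-sym u≋p)) u∈t))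

    ⋖′-⇔ : ∀ {k} (ρ : Vector Carrier k) c z →
           _⊨_ 𝓐 ρ (c ⋖′ z) ⇔ (∃ λ p → IsPrincipal p (ρ c) (ρ z))
    ⋖′-⇔ ρ c z = ⇔.trans (⋖′-⇔-Covers ρ c z) (Covers-⇔-IsPrincipal (ρ c) (ρ z))

    ⊆-⇔-≼ : ∀ (a b : Carrier) (p q : Pt) → ⌊ a ⌋ ≐ set (↓ p) → ⌊ b ⌋ ≐ set (↓ q) →
            (⌊ a ⌋ ⊆ ⌊ b ⌋) ⇔ (proj₁ p ≼ proj₁ q)
    ⊆-⇔-≼ a b p q (a⊆ , ⊆a) (b⊆ , ⊆b) = mk⇔
      (λ a⊆b → b⊆ (a⊆b (⊆a {p} (inj₂ ≋-refl))))
      (λ p≼q {u} u∈a → ⊆b {u} (Poset.trans K {u} {p} {q} (a⊆ u∈a) p≼q))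

    ≐-⇔-≋ : ∀ (a b : Carrier) (p q : Pt) → ⌊ a ⌋ ≐ set (↓ p) → ⌊ b ⌋ ≐ set (↓ q) →
            (⌊ a ⌋ ≐ ⌊ b ⌋) ⇔ (proj₁ p ≋ proj₁ q)
    ≐-⇔-≋ a b p q a≐ b≐ = mk⇔ forth back
      where
      forth : ⌊ a ⌋ ≐ ⌊ b ⌋ → proj₁ p ≋ proj₁ q
      forth (a⊆b , b⊆a) = Poset.antisym K {p} {q} (to (⊆-⇔-≼ a b p q a≐ b≐) a⊆b) (to (⊆-⇔-≼ b a q p b≐ a≐) b⊆a)
      back : proj₁ p ≋ proj₁ q → ⌊ a ⌋ ≐ ⌊ b ⌋
      back p≋q = from (⊆-⇔-≼ a b p q a≐ b≐) (inj₂ p≋q) , from (⊆-⇔-≼ b a q p b≐ a≐) (inj₂ (≋-sym p≋q))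

    -- By `⋖′-⇔` the two covering elements are principal, and their generators are the two points of
    -- `Twins`; `val-spec` does the rest.
    valued′-⇔ : ∀ {k} (ρ : Vector Carrier k) a x {i} {p : Pt} →
                ρ a ≡ (preGenerator i , preGenerator∈H i) → ⌊ ρ x ⌋ ≐ set (↓ p) →
                _⊨_ 𝓐 ρ (valued′ a x) ⇔ i Subset.∈ val (proj₁ p)
    valued′-⇔ ρ a x {i} {p} ρa≡ (x⊆ , ⊆x) = mk⇔ (from (val-spec i p) ∘ forth) (back ∘ to (val-spec i p))
      where
      atom : Pt
      atom = w ⁅ i ⁆ [] , 0 , atom∈K^ i 0
      a⊆ : ⌊ ρ a ⌋ ⊆ set (preGenerator i)
      a⊆ {u} = subst (λ b → u ∈ ⌊ b ⌋) ρa≡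
      ⊆a : set (preGenerator i) ⊆ ⌊ ρ a ⌋
      ⊆a {u} = subst (λ b → u ∈ ⌊ b ⌋) (sym ρa≡)
      join-to : ⌊ ρ a ⌋ ∪ ⌊ ρ x ⌋ ⊆ join i p
      join-to {u} = Sum.map (a⊆ {u}) (x⊆ {u})
      join-from : join i p ⊆ ⌊ ρ a ⌋ ∪ ⌊ ρ x ⌋
      join-from {u} = Sum.map (⊆a {u}) (⊆x {u})

      below≐ : ∀ c s → ⌊ c ⌋ ≐ ⌊ ρ a ⌋ ∪ ⌊ ρ x ⌋ → ⌊ c ⌋ ≐ set (↓° s) → set (↓° s) ≐ join i p
      below≐ c s (c⊆ , ⊆c) (c⊆s , s⊆c) =
        (λ {u} u<s → join-to {u} (c⊆ (s⊆c {u} u<s))) , λ {u} u∈S → c⊆s (⊆c {u} (join-from {u} u∈S))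

      forth : _⊨_ 𝓐 ρ (valued′ a x) → Twins i p
      forth (c , lift c≐ , y , z , c⋖y , c⋖z , y≈z⇒a⊑x) = spread
        (to (⋖′-⇔ ρ′ (suc (suc zero)) (suc zero)) c⋖y) (to (⋖′-⇔ ρ′ (suc (suc zero)) zero) c⋖z)
        where
        ρ′ : Vector Carrier (3 ℕ.+ _)
        ρ′ = z Vector.∷ y Vector.∷ c Vector.∷ ρ
        spread : (∃ λ q → IsPrincipal q c y) → (∃ λ r → IsPrincipal r c z) → Twins i p
        spread (q , y≐ , c≐q) (r , z≐ , c≐r) = q , r , below≐ c q c≐ c≐q , below≐ c r c≐ c≐r ,
          λ q≋r → x⊆ {atom} (to (⊑′-⇔ ρ′ (suc (suc (suc a))) (suc (suc (suc x))))
                      (y≈z⇒a⊑x (lift (from (≐-⇔-≋ y z q r y≐ z≐) q≋r))) (⊆a {atom} ≋-refl))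

      back : Twins i p → _⊨_ 𝓐 ρ (valued′ a x)
      back (q , r , q° , r° , q≋r⇒a≼p) =
        c , lift (id , id) , principal q , principal r ,
        from (⋖′-⇔ ρ′ (suc (suc zero)) (suc zero)) (q , (id , id) , cover q q°) ,
        from (⋖′-⇔ ρ′ (suc (suc zero)) zero) (r , (id , id) , cover r r°) ,
        λ (lift y≈z) → from (⊑′-⇔ ρ′ (suc (suc (suc a))) (suc (suc (suc x))))
          λ {u} u∈a → ⊆x {u} (≼-respˡ (a⊆ {u} u∈a)
            (q≋r⇒a≼p (to (≐-⇔-≋ (principal q) (principal r) q r (id , id) (id , id)) y≈z)))
        where
        c : Carrier
        c = Structure.fun 𝓐 ⊔ʰ (ρ a Vector.∷ ρ x Vector.∷ Vector.[])
        ρ′ : Vector Carrier (3 ℕ.+ _)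
        ρ′ = principal r Vector.∷ principal q Vector.∷ c Vector.∷ ρ
        cover : ∀ s → set (↓° s) ≐ join i p → ⌊ c ⌋ ≐ set (↓° s)
        cover s (s⊆ , ⊆s) = (λ {u} u∈c → ⊆s {u} (join-to {u} u∈c)) , λ {u} u<s → join-from {u} (s⊆ {u} u<s)

    -- The interpretation and its correctness

    params : Vector Carrier n
    params i = preGenerator i , preGenerator∈H i

    domain′ : Formula ℒHA (n ℕ.+ 1)
    domain′ = ∃′ (zero ⋖′ suc (n ↑ʳ zero))

    -- Jointly they force val x = I, asserting P_i for i ∈ I and denying it for all other i.
    literals : Subset n → Vector (Formula ℒHA (n ℕ.+ 1)) n
    literals I i = literal′ (i ∈? I) (valued′ (i ↑ˡ 1) (n ↑ʳ zero))

    -- No clause for `graph` arises, as `ℒK` has no function symbols.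
    formula′ : (α : Atomic ℒK) → Formula ℒHA (n ℕ.+ arity α ℕ.* 1)
    formula′ equality                 = var (n ↑ʳ zero) ≈′ var (n ↑ʳ suc zero)
    formula′ (relation order)         = (n ↑ʳ zero) ⊑′ (n ↑ʳ suc zero)
    formula′ (relation (valuation I)) = ⋀′ (literals I)

    -- The coordinate map returns the point obtained here, which `≐-⇔-≋` shows to be unique up to
    -- `_≋_`.
    domain-⇔ : ∀ (xs : Vector Carrier 1) →
               _⊨_ 𝓐 (params Vector.++ xs) domain′ ⇔ (∃ λ p → ⌊ xs zero ⌋ ≐ set (↓ p))
    domain-⇔ xs = mk⇔
      (λ (c , c⋖x) →
         let p , x≐ , _ = to (⋖′-⇔ (c Vector.∷ params Vector.++ xs) zero (suc (n ↑ʳ zero))) c⋖x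
         in  p , subst (λ b → ⌊ b ⌋ ≐ set (↓ p)) x≡ x≐)
      (λ (p , x≐) → lowerCover p ,
         from (⋖′-⇔ (lowerCover p Vector.∷ params Vector.++ xs) zero (suc (n ↑ʳ zero)))
              (p , subst (λ b → ⌊ b ⌋ ≐ set (↓ p)) (sym x≡) x≐ , (id , id)))
      where
      x≡ : (params Vector.++ xs) (n ↑ʳ zero) ≡ xs zero
      x≡ = lookup-++ʳ params xs zero

    interpretation : Interpretation 𝓐 params 𝔎
    interpretation = record
      { dim        = 1
      ; domain     = domain′
      ; formula    = formula′
      ; coordinate = λ xs xs∈ → proj₁ (to (domain-⇔ xs) xs∈)
      ; surjective = surjective
      ; correct    = correct
      }
      where
      surjective : ∀ p → ∃ λ xs → Σ (_⊨_ 𝓐 (params Vector.++ xs) domain′) λ xs∈ →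
                   proj₁ (proj₁ (to (domain-⇔ xs) xs∈)) ≋ proj₁ p
      surjective p = xs , xs∈ ,
        -- The extracted point `q` need not be `p` literally, but ↓ q = ↓ p.
        let q , x≐ = to (domain-⇔ xs) xs∈
        in  to (≐-⇔-≋ (principal p) (principal p) q p x≐ (id , id)) (id , id)
        where
        xs : Vector Carrier 1
        xs _ = principal p
        xs∈ : _⊨_ 𝓐 (params Vector.++ xs) domain′
        xs∈ = from (domain-⇔ xs) (p , id , id)

      module _ {m : ℕ} (xss : Vector (Vector Carrier 1) m) (xss∈ : ∀ i → _⊨_ 𝓐 (params Vector.++ xss i) domain′) where
        ρ : Vector Carrier (n ℕ.+ m ℕ.* 1)
        ρ = params Vector.++ Vector.concat xss

        point : Fin m → Pt
        point i = proj₁ (to (domain-⇔ (xss i)) (xss∈ i))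

        -- Tuples have length 1, so `j` numbers the same element as `i`; for the concrete indices
        -- below `eq` is `refl`.
        principal-at : ∀ i j → Vector.concat xss j ≡ xss i zero → ⌊ ρ (n ↑ʳ j) ⌋ ≐ set (↓ (point i))
        principal-at i j eq = subst (λ b → ⌊ b ⌋ ≐ set (↓ (point i)))
          (sym (trans (lookup-++ʳ params (Vector.concat xss) j) eq)) (proj₂ (to (domain-⇔ (xss i)) (xss∈ i)))

      correct : ∀ α (xss : Vector (Vector Carrier 1) (arity α))
                (xss∈ : ∀ i → _⊨_ 𝓐 (params Vector.++ xss i) domain′) →
                _⊨_ 𝓐 (params Vector.++ Vector.concat xss) (formula′ α) ⇔
                Holds 𝔎 α (λ i → proj₁ (to (domain-⇔ (xss i)) (xss∈ i)))
      correct equality xss xss∈ = mk⇔ (λ (lift x≈y) → to ≐⇔≋ x≈y) (λ p≋q → lift (from ≐⇔≋ p≋q))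
        where
        ≐⇔≋ = ≐-⇔-≋ (ρ xss xss∈ (n ↑ʳ zero)) (ρ xss xss∈ (n ↑ʳ suc zero))
                (point xss xss∈ zero) (point xss xss∈ (suc zero))
                (principal-at xss xss∈ zero zero refl) (principal-at xss xss∈ (suc zero) (suc zero) refl)
      correct (relation order) xss xss∈ = mk⇔
        (λ x⊑y → to ⊆⇔≼ (to (⊑′-⇔ (ρ xss xss∈) (n ↑ʳ zero) (n ↑ʳ suc zero)) x⊑y))
        (λ p≼q → from (⊑′-⇔ (ρ xss xss∈) (n ↑ʳ zero) (n ↑ʳ suc zero)) (from ⊆⇔≼ p≼q))
        where
        ⊆⇔≼ = ⊆-⇔-≼ (ρ xss xss∈ (n ↑ʳ zero)) (ρ xss xss∈ (n ↑ʳ suc zero))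
                (point xss xss∈ zero) (point xss xss∈ (suc zero))
                (principal-at xss xss∈ zero zero refl) (principal-at xss xss∈ (suc zero) (suc zero) refl)
      correct (relation (valuation I)) xss xss∈ = mk⇔ forth back
        where
        p : Pt
        p = point xss xss∈ zero
        valued : Fin n → Formula ℒHA (n ℕ.+ 1)
        valued i = valued′ (i ↑ˡ 1) (n ↑ʳ zero)
        t⇔∈val : ∀ i → _⊨_ 𝓐 (ρ xss xss∈) (valued i) ⇔ i Subset.∈ val (proj₁ p)
        t⇔∈val i = valued′-⇔ (ρ xss xss∈) (i ↑ˡ 1) (n ↑ʳ zero) {i} {p}
                     (lookup-++ˡ params (Vector.concat xss) i) (principal-at xss xss∈ zero zero refl)
        forth : _⊨_ 𝓐 (ρ xss xss∈) (⋀′ (literals I)) → val (proj₁ p) ≡ I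
        forth t = ⊆-antisym (λ {i} i∈ → to (t⇔∈I i) (from (t⇔∈val i) i∈))
                            (λ {i} i∈ → to (t⇔∈val i) (from (t⇔∈I i) i∈))
          where
          t⇔∈I : ∀ i → _⊨_ 𝓐 (ρ xss xss∈) (valued i) ⇔ i Subset.∈ I
          t⇔∈I i = to (literal′-⇔ 𝓐 (ρ xss xss∈) (i ∈? I) (valued i))
                      (to (⋀′-⇔ 𝓐 (ρ xss xss∈) (literals I)) t i)
        back : val (proj₁ p) ≡ I → _⊨_ 𝓐 (ρ xss xss∈) (⋀′ (literals I))
        back val≡I = from (⋀′-⇔ 𝓐 (ρ xss xss∈) (literals I)) λ i →
          from (literal′-⇔ 𝓐 (ρ xss xss∈) (i ∈? I) (valued i))
            (subst (λ J → _⊨_ 𝓐 (ρ xss xss∈) (valued i) ⇔ (i Subset.∈ J)) val≡I (t⇔∈val i))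

corollary6p2 : (em : ∀ {ℓ} → ExcludedMiddle ℓ) →
    ∀ {h} (n : ℕ) → n ≥ 1 →
    let open GenericModel n
        open Classical em
    in (H : Pred (DownSet K) h) (dense : IsDense H) →
       Σ (∀ i → preGenerator i ∈ H) λ a∈H →
         Interpretation (substructure F̂ (IsDense.isSubalgebra dense)) (λ i → preGenerator i , a∈H i) 𝔎
corollary6p2 em n _ H dense = preGenerator∈H , interpretation
  where open DenseSubalgebra n em H dense
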